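{- For every integer $n\ge 2$ there exists a double-$n$ string with diameter at most $5\lceil n/13\rceil-1$. Consequently $\delta(n)\le 5\lceil n/13\rceil -1$ for all $n\ge 2$, and $\limsup_{n\to\infty}\delta(n)/n\le 5/13$.
   Context: A double-$n$ string is a string of length $2n$ over an alphabet of $n$ symbols in which each symbol appears exactly twice. Positions in the string are numbered $1,\dots,2n$. The distance between two distinct symbols is the minimum, over an occurrence of the first symbol and an occurrence of the second, of the absolute difference of their positions. The diameter of a double-$n$ string ($n\ge 2$) is the maximum of the distance over all pairs of distinct symbols. $\delta(n)$ denotes the minimum diameter over all double-$n$ strings. -}

module Defs where

open import Data.Bool.Base using (true; false)
open import Data.Fin.Base using (Fin; zero; suc; toℕ)
open import Data.Fin.Properties using (_≟_; toℕ<n; all?; 0≢1+n; suc-injective)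
import Data.Integer.Base as ℤ
open import Data.List.Base using (List; []; _∷_; map; filter; allFin; cartesianProduct; cartesianProductWith)
open import Data.List.Extrema.Nat using (min; max; argmin-sel; argmax-sel; min≤⊤; min≤xs; xs≤max; max≤v⁺)
open import Data.List.Membership.Propositional using (_∈_)
open import Data.List.Membership.Propositional.Properties
  using (∈-map⁺; ∈-map⁻; ∈-filter⁺; ∈-filter⁻; ∈-allFin; ∈-cartesianProduct⁺;
         ∈-cartesianProduct⁻; ∈-cartesianProductWith⁺)
open import Data.List.Relation.Unary.Any using (here)
import Data.List.Relation.Unary.All as All
import Data.List.Relation.Unary.All.Properties as All
open import Data.Nat.Base using (ℕ; zero; suc; _+_; _*_; _≤_; _<_; z≤n; s≤s; ∣_-_∣)
open import Data.Nat.Properties as ℕ using ()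
open import Data.Product.Base using (_×_; _,_; ∃-syntax; proj₂; uncurry)
open import Data.Rational.Base as ℚ using (ℚ; 0ℚ)
open import Data.Sum.Base using (inj₁; inj₂)
open import Data.Vec.Base as Vec using (Vec; []; _∷_; lookup; count)
open import Function.Base using (id; _∘_)
open import Relation.Binary.PropositionalEquality
open import Relation.Nullary using (¬_; Dec; yes; no; does; ¬?; contradiction)

IsDouble : ∀ {n} → Vec (Fin n) (2 * n) → Set
IsDouble {n} s = (a : Fin n) → count (_≟ a) s ≡ 2

isDouble? : ∀ {n} (s : Vec (Fin n) (2 * n)) → Dec (IsDouble s)
isDouble? s = all? λ a → count (_≟ a) s ℕ.≟ 2

module _ {n : ℕ} (s : Vec (Fin n) (2 * n)) where

  -- Positions are 0, …, 2n-1 rather than 1, …, 2n; only their differences matter.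
  occurrences : Fin n → List (Fin (2 * n))
  occurrences a = filter (λ i → lookup s i ≟ a) (allFin (2 * n))

  gaps : Fin n → Fin n → List ℕ
  gaps a b = map (λ (i , j) → ∣ toℕ i - toℕ j ∣)
                 (cartesianProduct (occurrences a) (occurrences b))

  -- 2 * n is only the value for an empty list of gaps: every gap is smaller.
  distance : Fin n → Fin n → ℕ
  distance a b = min (2 * n) (gaps a b)

  distinctPairs : List (Fin n × Fin n)
  distinctPairs = filter (λ (a , b) → ¬? (a ≟ b)) (cartesianProduct (allFin n) (allFin n))

  diameter : ℕ
  diameter = max 0 (map (uncurry distance) distinctPairs)

words : ∀ n k → List (Vec (Fin n) k)
words n zero    = [] ∷ []
words n (suc k) = cartesianProductWith _∷_ (allFin n) (words n k)

doubleStrings : ∀ n → List (Vec (Fin n) (2 * n))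
doubleStrings n = filter isDouble? (words n (2 * n))

-- The default 2 * n is never below a diameter, and doubleStrings n is nonempty;
-- see δ-attained and δ-minimal.
δ : ℕ → ℕ
δ n = min (2 * n) (map diameter (doubleStrings n))

-- The value at 0, where δ(n)/n is undefined, is irrelevant to the limit superior.
δ/n : ℕ → ℚ
δ/n zero      = 0ℚ
δ/n n@(suc _) = ℤ.+ δ n ℚ./ n

-- inf_N sup_{n ≥ N} aₙ ≤ L: for every ε > 0, L + ε bounds some tail from above.
-- The limit superior itself is a real number (or ±∞), so only this comparison
-- is defined.
limsup_≤_ : (ℕ → ℚ) → ℚ → Set
limsup a ≤ L = ∀ ε → 0ℚ ℚ.< ε → ∃[ N ] (∀ n → N ≤ n → a n ℚ.≤ L ℚ.+ ε)

infix 4 limsup_≤_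

------------------------------------------------------------------------
-- distance, diameter and δ are the intended extrema

private
  occurs : ∀ {n k} (a : Fin n) (s : Vec (Fin n) k) → 1 ≤ count (_≟ a) s →
           ∃[ i ] lookup s i ≡ a
  occurs a (x ∷ s) p with x ≟ a
  ... | yes x≡a = zero , x≡a
  ... | no  _   = let i , eq = occurs a s p in suc i , eq

  twoSymbols : ∀ {n} → 2 ≤ n → ∃[ a ] ∃[ b ] ¬ _≡_ {A = Fin n} a b
  twoSymbols (s≤s (s≤s _)) = zero , suc zero , λ ()

  ∈-words : ∀ {n k} (w : Vec (Fin n) k) → w ∈ words n k
  ∈-words []      = here refl
  ∈-words (a ∷ w) = ∈-cartesianProductWith⁺ _∷_ (∈-allFin a) (∈-words w)

module _ {n : ℕ} (s : Vec (Fin n) (2 * n)) where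

  private
    ∈-gaps : ∀ i j → ∣ toℕ i - toℕ j ∣ ∈ gaps s (lookup s i) (lookup s j)
    ∈-gaps i j = ∈-map⁺ _ (∈-cartesianProduct⁺ (∈-filter⁺ _ (∈-allFin i) refl)
                                                (∈-filter⁺ _ (∈-allFin j) refl))

    gap<2n : ∀ (i j : Fin (2 * n)) → ∣ toℕ i - toℕ j ∣ < 2 * n
    gap<2n i j = ℕ.≤-<-trans (ℕ.∣m-n∣≤m⊔n (toℕ i) (toℕ j)) (ℕ.⊔-lub (toℕ<n i) (toℕ<n j))

  distance-minimal : ∀ i j → distance s (lookup s i) (lookup s j) ≤ ∣ toℕ i - toℕ j ∣
  distance-minimal i j = All.lookup (min≤xs _ _) (∈-gaps i j)

  distance-attained : IsDouble s → ∀ a b →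
    ∃[ i ] ∃[ j ] lookup s i ≡ a × lookup s j ≡ b × ∣ toℕ i - toℕ j ∣ ≡ distance s a b
  distance-attained dbl a b with argmin-sel id (2 * n) (gaps s a b)
  ... | inj₂ d∈
    with (i , j) , ij∈ , eq ← ∈-map⁻ _ d∈
    with i∈ , j∈ ← ∈-cartesianProduct⁻ _ _ ij∈
    = i , j , proj₂ (∈-filter⁻ _ {xs = allFin (2 * n)} i∈)
    , proj₂ (∈-filter⁻ _ {xs = allFin (2 * n)} j∈) , sym eq
  ... | inj₁ d≡2n
    with i , refl ← occurs a s (subst (1 ≤_) (sym (dbl a)) (s≤s z≤n))
    with j , refl ← occurs b s (subst (1 ≤_) (sym (dbl b)) (s≤s z≤n))
    = contradiction (subst (_≤ _) d≡2n (distance-minimal i j)) (ℕ.<⇒≱ (gap<2n i j))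

  diameter-maximal : ∀ a b → ¬ a ≡ b → distance s a b ≤ diameter s
  diameter-maximal a b a≢b = All.lookup (xs≤max 0 _)
    (∈-map⁺ _ (∈-filter⁺ _ (∈-cartesianProduct⁺ (∈-allFin a) (∈-allFin b)) a≢b))

  diameter≤2n : diameter s ≤ 2 * n
  diameter≤2n = max≤v⁺ z≤n
    (All.map⁺ (All.tabulate {xs = distinctPairs s} λ {(a , b)} _ → min≤⊤ (2 * n) (gaps s a b)))

  diameter-attained : 2 ≤ n → ∃[ a ] ∃[ b ] ¬ a ≡ b × distance s a b ≡ diameter s
  diameter-attained 2≤n with argmax-sel id 0 (map (uncurry (distance s)) (distinctPairs s))
  ... | inj₂ d∈ with (a , b) , ab∈ , eq ← ∈-map⁻ _ d∈
    = a , b , proj₂ (∈-filter⁻ _ {xs = cartesianProduct (allFin n) (allFin n)} ab∈) , sym eq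
  ... | inj₁ d≡0 with a , b , a≢b ← twoSymbols 2≤n
    = a , b , a≢b , trans (ℕ.n≤0⇒n≡0 (subst (distance s a b ≤_) d≡0 (diameter-maximal a b a≢b))) (sym d≡0)

private
  count-++ : ∀ {n k l} (a : Fin n) (v : Vec (Fin n) k) (w : Vec (Fin n) l) →
             count (_≟ a) (v Vec.++ w) ≡ count (_≟ a) v + count (_≟ a) w
  count-++ a []      w = refl
  count-++ a (x ∷ v) w with does (x ≟ a)
  ... | true  = cong suc (count-++ a v w)
  ... | false = count-++ a v w

  count-none : ∀ {n k} (a : Fin n) (f : Fin k → Fin n) → (∀ i → ¬ f i ≡ a) →
               count (_≟ a) (Vec.tabulate f) ≡ 0
  count-none {k = zero}  a f f≢a = refl
  count-none {k = suc _} a f f≢a with f zero ≟ a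
  ... | yes f0≡a = contradiction f0≡a (f≢a zero)
  ... | no  _    = count-none a (f ∘ suc) (f≢a ∘ suc)

  count-once : ∀ {n k} (f : Fin k → Fin n) → (∀ {i j} → f i ≡ f j → i ≡ j) → ∀ i →
               count (_≟ f i) (Vec.tabulate f) ≡ 1
  count-once f inj zero with f zero ≟ f zero
  ... | yes _   = cong suc (count-none (f zero) (f ∘ suc) λ i eq → 0≢1+n (inj (sym eq)))
  ... | no  neq = contradiction refl neq
  count-once f inj (suc i) with f zero ≟ f (suc i)
  ... | yes eq = contradiction (inj eq) 0≢1+n
  ... | no  _  = count-once (f ∘ suc) (suc-injective ∘ inj) i

  doubled : ∀ n → Vec (Fin n) (2 * n)
  doubled n = Vec.allFin n Vec.++ (Vec.allFin n Vec.++ [])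

  doubled-isDouble : ∀ n → IsDouble (doubled n)
  doubled-isDouble n a = begin
    count (_≟ a) (doubled n)
      ≡⟨ count-++ a (Vec.allFin n) _ ⟩
    count (_≟ a) (Vec.allFin n) + count (_≟ a) (Vec.allFin n Vec.++ [])
      ≡⟨ cong (count (_≟ a) (Vec.allFin n) +_) (count-++ a (Vec.allFin n) []) ⟩
    count (_≟ a) (Vec.allFin n) + (count (_≟ a) (Vec.allFin n) + 0)
      ≡⟨ cong (λ c → c + (c + 0)) (count-once id id a) ⟩
    2 ∎
    where open ≡-Reasoning

δ-minimal : ∀ {n} (s : Vec (Fin n) (2 * n)) → IsDouble s → δ n ≤ diameter s
δ-minimal s dbl = All.lookup (min≤xs _ _)
  (∈-map⁺ diameter (∈-filter⁺ isDouble? (∈-words s) dbl))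

δ-attained : ∀ n → ∃[ s ] IsDouble {n} s × diameter s ≡ δ n
δ-attained n with argmin-sel id (2 * n) (map diameter (doubleStrings n))
... | inj₂ d∈ with s , s∈ , eq ← ∈-map⁻ diameter d∈
  = s , proj₂ (∈-filter⁻ isDouble? {xs = words n (2 * n)} s∈) , sym eq
... | inj₁ δ≡2n = doubled n , doubled-isDouble n ,
  ℕ.≤-antisym (subst (diameter (doubled n) ≤_) (sym δ≡2n) (diameter≤2n (doubled n)))
              (δ-minimal (doubled n) (doubled-isDouble n))

{-# OPTIONS --safe #-}

-- A double-13 string w of diameter 4 exists: any two of its letters occur in
-- a common window of five consecutive positions.  Cut the n symbols into 13
-- chunks of at most k = ⌈n/13⌉ symbols and replace every letter c of w by the
-- c-th chunk.  Any two symbols then lie in the image of a common window, which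
-- has at most 5k symbols, so their distance is at most 5k - 1.
-- Hence δ(n)/n ≤ 5/13 + 4/n, which gives the limit superior.
module Submission where

open import Defs
open import Data.Nat as ℕ using (ℕ)
open import Data.Integer using (ℤ; +_; _*_; _-_; _≤_)
open import Data.Rational using (_/_; ceiling)
open import Data.Product using (_×_; ∃-syntax)
open import Data.Fin using (Fin; zero; suc; toℕ; #_)
open import Data.Fin.Properties as Fin using (_≟_; all?; any?)
import Data.Integer as ℤ
import Data.Integer.DivMod as ℤ
import Data.Integer.GCD as ℤ
import Data.Integer.Properties as ℤ
open import Data.List.Base as List
  using (List; []; _∷_; _++_; length; concat; concatMap; filter; take; drop; allFin; tabulate)
import Data.List.Properties as List
open import Data.List.Membership.DecPropositional {A = Fin 13} _≟_ using (_∈?_)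
open import Data.List.Membership.Propositional using (_∈_; lose)
open import Data.List.Membership.Propositional.Properties using (∈-concatMap⁺; ∈-concatMap⁻; ∈-allFin)
import Data.List.Relation.Unary.All.Properties as All
open import Data.List.Relation.Unary.Any using (here; there; satisfied)
open import Data.List.Relation.Binary.Permutation.Propositional as ↭
  using (_↭_; ↭-sym; ↭-trans; ↭-reflexive)
open import Data.List.Relation.Binary.Permutation.Propositional.Properties
  using (++⁺ˡ; shifts; filter-↭; ↭-length)
open import Data.List.Sort.InsertionSort.Properties (Fin.≤-decTotalOrder 13) using (sort-↭)
import Data.Nat.DivMod as ℕ
import Data.Nat.Properties as ℕ
open import Data.Nat.Tactic.RingSolver using (solve-∀)
open import Data.Product using (_,_; proj₁; proj₂)
import Data.Rational as ℚ
import Data.Rational.Properties as ℚ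
import Data.Rational.Unnormalised as ℚᵘ
import Data.Rational.Unnormalised.Properties as ℚᵘ
open import Data.Vec.Base as Vec using (Vec; []; _∷_; lookup; count; toList; fromList)
import Data.Vec.Properties as Vec
open import Function.Base using (_∘_; id)
open import Relation.Binary.PropositionalEquality
open import Relation.Nullary.Decidable using (_×-dec_; yes; no; from-yes)
open import Relation.Nullary.Negation using (contradiction)

private
  variable
    A B : Set
    k m n : ℕ

-- Images of words and division of a list into chunks.

concatMap-↭ : (f : A → List B) {xs ys : List A} → xs ↭ ys → concatMap f xs ↭ concatMap f ys
concatMap-↭ f ↭.refl         = ↭.refl
concatMap-↭ f (↭.prep x p)   = ++⁺ˡ (f x) (concatMap-↭ f p)
concatMap-↭ f (↭.swap x y p) =
  ↭-trans (shifts (f x) (f y)) (++⁺ˡ (f y) (++⁺ˡ (f x) (concatMap-↭ f p)))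
concatMap-↭ f (↭.trans p q)  = ↭-trans (concatMap-↭ f p) (concatMap-↭ f q)

length-concatMap-≤ : (f : A → List B) → (∀ x → length (f x) ℕ.≤ k) →
                     ∀ xs → length (concatMap f xs) ℕ.≤ length xs ℕ.* k
length-concatMap-≤ f f≤k []       = ℕ.z≤n
length-concatMap-≤ f f≤k (x ∷ xs) = ℕ.≤-trans (ℕ.≤-reflexive (List.length-++ (f x)))
  (ℕ.+-mono-≤ (f≤k x) (length-concatMap-≤ f f≤k xs))

-- Once the list is exhausted the remaining chunks are empty, so any length up to `m * k` is
-- covered.
chunk : ℕ → List A → Fin m → List A
chunk k xs zero    = take k xs
chunk k xs (suc i) = chunk k (drop k xs) i

length-chunk : (xs : List A) (i : Fin m) → length (chunk k xs i) ℕ.≤ k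
length-chunk {k = k} xs zero    = ℕ.≤-trans (ℕ.≤-reflexive (List.length-take k xs)) (ℕ.m⊓n≤m k _)
length-chunk {k = k} xs (suc i) = length-chunk (drop k xs) i

concat-chunks : ∀ m (xs : List A) → length xs ℕ.≤ m ℕ.* k →
                concat (tabulate {n = m} (chunk k xs)) ≡ xs
concat-chunks         ℕ.zero    []  _  = refl
concat-chunks {k = k} (ℕ.suc m) xs  le = begin
  take k xs ++ concat (tabulate {n = m} (chunk k (drop k xs)))
    ≡⟨ cong (take k xs ++_) (concat-chunks m (drop k xs) (subst₂ ℕ._≤_
         (sym (List.length-drop k xs)) (ℕ.m+n∸m≡n k (m ℕ.* k)) (ℕ.∸-monoˡ-≤ k le))) ⟩
  take k xs ++ drop k xs
    ≡⟨ List.take++drop≡id k xs ⟩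
  xs ∎
  where open ≡-Reasoning

concatMap-chunk : ∀ m (xs : List A) → length xs ℕ.≤ m ℕ.* k →
                  concatMap (chunk k xs) (allFin m) ≡ xs
concatMap-chunk m xs le = trans (cong concat (List.map-tabulate {n = m} id (chunk _ xs)))
                                (concat-chunks m xs le)

-- Positions of symbols inside an infix.

index< : (v : Vec A m) {vs ws : List A} → toList v ≡ vs ++ ws → ∀ {a} → a ∈ vs →
         ∃[ i ] (lookup v i ≡ a × toℕ i ℕ.< length vs)
index< []      ()   (here _)
index< []      ()   (there _)
index< (x ∷ v) eq   (here refl) = zero , List.∷-injectiveˡ eq , ℕ.s≤s ℕ.z≤n
index< (x ∷ v) eq   (there a∈)  =
  let i , vi≡a , i< = index< v (List.∷-injectiveʳ eq) a∈ in suc i , vi≡a , ℕ.s≤s i<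

-- Removing the prefix `us` shifts both positions equally and keeps their difference. With no prefix
-- left, both positions lie below `length vs`, hence so does the difference.
gap<infix : (v : Vec A m) (us : List A) {vs ws : List A} → toList v ≡ us ++ vs ++ ws →
            ∀ {a b} → a ∈ vs → b ∈ vs →
            ∃[ i ] ∃[ j ] (lookup v i ≡ a × lookup v j ≡ b × ℕ.∣ toℕ i - toℕ j ∣ ℕ.< length vs)
gap<infix v [] eq a∈ b∈ =
  let i , vi≡a , i< = index< v eq a∈
      j , vj≡b , j< = index< v eq b∈
  in i , j , vi≡a , vj≡b , ℕ.≤-<-trans (ℕ.∣m-n∣≤m⊔n (toℕ i) (toℕ j)) (ℕ.⊔-lub i< j<)
gap<infix (x ∷ v) (_ ∷ us) eq a∈ b∈ =
  let i , j , rest = gap<infix v us (List.∷-injectiveʳ eq) a∈ b∈ in suc i , suc j , rest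

-- Double strings from rearrangements of two copies of the alphabet.

count-toList : (a : Fin n) (v : Vec (Fin n) m) → count (_≟ a) v ≡ length (filter (_≟ a) (toList v))
count-toList a []      = refl
count-toList a (x ∷ v) with x ≟ a
... | yes _ = cong ℕ.suc (count-toList a v)
... | no  _ = count-toList a v

-- Only `f = id` is wanted; an arbitrary injective `f` lets the induction pass to `f ∘ suc`.
occurrences-tabulate : (f : Fin m → Fin n) → (∀ {i j} → f i ≡ f j → i ≡ j) → ∀ i →
                       length (filter (_≟ f i) (tabulate f)) ≡ 1
occurrences-tabulate f inj zero with f zero ≟ f zero
... | yes _   = cong (ℕ.suc ∘ length)
                  (List.filter-none (_≟ f zero)
                    (All.tabulate⁺ {f = f ∘ suc} λ i eq → Fin.0≢1+n (inj (sym eq))))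
... | no  neq = contradiction refl neq
occurrences-tabulate f inj (suc i) with f zero ≟ f (suc i)
... | yes eq = contradiction (inj eq) Fin.0≢1+n
... | no  _  = occurrences-tabulate (f ∘ suc) (Fin.suc-injective ∘ inj) i

occurrences-twice : {xs : List (Fin n)} → xs ↭ allFin n ++ allFin n →
                    ∀ a → length (filter (_≟ a) xs) ≡ 2
occurrences-twice {n} {xs} p a = begin
  length (filter (_≟ a) xs)
    ≡⟨ ↭-length (filter-↭ (_≟ a) p) ⟩
  length (filter (_≟ a) (allFin n ++ allFin n))
    ≡⟨ cong length (List.filter-++ (_≟ a) (allFin n) (allFin n)) ⟩
  length (filter (_≟ a) (allFin n) ++ filter (_≟ a) (allFin n))
    ≡⟨ List.length-++ (filter (_≟ a) (allFin n)) ⟩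
  length (filter (_≟ a) (allFin n)) ℕ.+ length (filter (_≟ a) (allFin n))
    ≡⟨ cong₂ ℕ._+_ (occurrences-tabulate id id a) (occurrences-tabulate id id a) ⟩
  2 ∎
  where open ≡-Reasoning

-- The length is a variable `m` so that the equation can be matched with `refl`; with `2 * n` in its
-- place unification would be stuck.
fromList-exact : (xs : List A) → length xs ≡ m → ∃[ v ] (toList {n = m} v ≡ xs)
fromList-exact xs refl = fromList xs , Vec.toList∘fromList xs

length-doubled : {xs : List (Fin n)} → xs ↭ allFin n ++ allFin n → length xs ≡ 2 ℕ.* n
length-doubled {n} {xs} p = begin
  length xs                               ≡⟨ ↭-length p ⟩
  length (allFin n ++ allFin n)           ≡⟨ List.length-++ (allFin n) ⟩
  length (allFin n) ℕ.+ length (allFin n) ≡⟨ cong (λ l → l ℕ.+ l) (List.length-tabulate {n = n} id) ⟩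
  n ℕ.+ n                                 ≡⟨ cong (n ℕ.+_) (ℕ.+-identityʳ n) ⟨
  2 ℕ.* n                                 ∎
  where open ≡-Reasoning

double-fromList : (xs : List (Fin n)) → xs ↭ allFin n ++ allFin n →
                  ∃[ s ] (IsDouble {n} s × toList s ≡ xs)
double-fromList xs p with s , refl ← fromList-exact xs (length-doubled p)
  = s , (λ a → trans (count-toList a s) (occurrences-twice p a)) , refl

-- The base word and its blow-up.

-- Found by computer search.
word₁₃ : List (Fin 13)
word₁₃ = # 0 ∷ # 1 ∷ # 2 ∷ # 3 ∷ # 4 ∷ # 5 ∷ # 6 ∷ # 7 ∷ # 8 ∷ # 9 ∷ # 10 ∷ # 2 ∷ # 1 ∷
         # 11 ∷ # 7 ∷ # 12 ∷ # 6 ∷ # 5 ∷ # 0 ∷ # 8 ∷ # 11 ∷ # 10 ∷ # 9 ∷ # 3 ∷ # 4 ∷ # 12 ∷ []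

-- Both sides sort to the same list, by computation.
word₁₃-↭ : word₁₃ ↭ allFin 13 ++ allFin 13
word₁₃-↭ = ↭-trans (↭-sym (sort-↭ word₁₃)) (sort-↭ (allFin 13 ++ allFin 13))

-- A word of length 26 has 26 - 5 + 1 = 22 windows of five consecutive letters.
window : Fin 22 → List (Fin 13)
window t = take 5 (drop (toℕ t) word₁₃)

-- Abstract, since unfolding the decision procedure at a variable t is infeasible.
abstract
  common-window : ∀ c d → ∃[ t ] (c ∈ window t × d ∈ window t)
  common-window = from-yes (all? λ c → all? λ d → any? λ t →
    (c ∈? window t) ×-dec (d ∈? window t))

blowUp : (Fin 13 → List A) → List A
blowUp f = concatMap f word₁₃

-- Cutting `word₁₃` before and after the window cuts its image likewise; this is the decomposition
-- that `gap<infix` takes.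
blowUp-window : (f : Fin 13 → List A) (t : Fin 22) →
                ∃[ us ] ∃[ ws ] (blowUp f ≡ us ++ concatMap f (window t) ++ ws)
blowUp-window f t = concatMap f prefix , concatMap f (drop 5 rest) , (begin
  concatMap f word₁₃
    ≡⟨ cong (concatMap f) (List.take++drop≡id (toℕ t) word₁₃) ⟨
  concatMap f (prefix ++ rest)
    ≡⟨ List.concatMap-++ f prefix rest ⟩
  concatMap f prefix ++ concatMap f rest
    ≡⟨ cong (λ ys → concatMap f prefix ++ concatMap f ys) (List.take++drop≡id 5 rest) ⟨
  concatMap f prefix ++ concatMap f (window t ++ drop 5 rest)
    ≡⟨ cong (concatMap f prefix ++_) (List.concatMap-++ f (window t) (drop 5 rest)) ⟩
  concatMap f prefix ++ concatMap f (window t) ++ concatMap f (drop 5 rest) ∎)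
  where
  open ≡-Reasoning
  prefix rest : List (Fin 13)
  prefix = take (toℕ t) word₁₃
  rest   = drop (toℕ t) word₁₃

-- `word₁₃` rearranges two copies of its alphabet, so its image rearranges two copies of the
-- concatenated chunks. This makes the blow-up a double string.
blowUp-↭ : (f : Fin 13 → List A) {xs : List A} → concatMap f (allFin 13) ≡ xs → blowUp f ↭ xs ++ xs
blowUp-↭ f refl = ↭-trans (concatMap-↭ f word₁₃-↭)
                          (↭-reflexive (List.concatMap-++ f (allFin 13) (allFin 13)))

-- Strings of small diameter.

-- The chunk size `k` is left free: it is taken to be the ceiling of n/13 for the exact bound, and
-- the floor plus one for the limit superior.
∃double-diameter< : 2 ℕ.≤ n → n ℕ.≤ 13 ℕ.* k → ∃[ s ] (IsDouble {n} s × diameter s ℕ.< 5 ℕ.* k)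
∃double-diameter< {n} {k} 2≤n n≤13k =
  let s , dbl , s≡ = double-fromList (blowUp f) (blowUp-↭ f chunks≡) in s , dbl , bound s s≡
  where
  f = chunk k (allFin n)

  chunks≡ : concatMap f (allFin 13) ≡ allFin n
  chunks≡ = concatMap-chunk {k = k} 13 (allFin n)
    (subst (ℕ._≤ 13 ℕ.* k) (sym (List.length-tabulate {n = n} id)) n≤13k)

  chunkOf : ∀ a → ∃[ c ] (a ∈ f c)
  chunkOf a = satisfied (∈-concatMap⁻ f {xs = allFin 13} (subst (a ∈_) (sym chunks≡) (∈-allFin a)))

  window-length : ∀ t → length (concatMap f (window t)) ℕ.≤ 5 ℕ.* k
  window-length t = ℕ.≤-trans
    (length-concatMap-≤ f (length-chunk {k = k} (allFin n)) (window t))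
    -- A window is itself a first chunk of size 5, so `length-chunk` bounds its length.
    (ℕ.*-monoˡ-≤ k (length-chunk {m = 1} {k = 5} (drop (toℕ t) word₁₃) zero))

  bound : ∀ s → toList s ≡ blowUp f → diameter s ℕ.< 5 ℕ.* k
  bound s s≡ =
    -- The diameter is the distance of some pair, so it suffices to bound the distance of that pair.
    let a , b , _ , distance≡ = diameter-attained s 2≤n
        c , a∈ = chunkOf a
        d , b∈ = chunkOf b
        t , c∈ , d∈ = common-window c d
        us , ws , split = blowUp-window f t
        i , j , sᵢ≡a , sⱼ≡b , gap< = gap<infix s us (trans s≡ split)
          (∈-concatMap⁺ f {xs = window t} (lose c∈ a∈)) (∈-concatMap⁺ f {xs = window t} (lose d∈ b∈))
    in begin-strict
    diameter s                           ≡⟨ distance≡ ⟨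
    distance s a b                       ≡⟨ cong₂ (distance s) sᵢ≡a sⱼ≡b ⟨
    distance s (lookup s i) (lookup s j) ≤⟨ distance-minimal s i j ⟩
    ℕ.∣ toℕ i - toℕ j ∣                  <⟨ gap< ⟩
    length (concatMap f (window t))      ≤⟨ window-length t ⟩
    5 ℕ.* k                              ∎
    where open ℕ.≤-Reasoning

-- The rational ceiling and the bound it gives.

floor*↧≤↥ : ∀ p → ℚ.floor p ℤ.* ℚ.↧ p ℤ.≤ ℚ.↥ p
floor*↧≤↥ p@record{} = ℤ.[n/d]*d≤n (ℚ.↥ p) (ℚ.↧ p)

-- `ceiling p` is the negated floor of `- p`, so this is the floor inequality for `- p` with signs
-- reversed.
↥≤ceiling*↧ : ∀ p → ℚ.↥ p ℤ.≤ ceiling p ℤ.* ℚ.↧ p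
↥≤ceiling*↧ p@record{} = begin
  ℚ.↥ p                                     ≡⟨ ℤ.neg-involutive (ℚ.↥ p) ⟨
  ℤ.- ℤ.- ℚ.↥ p                             ≡⟨ cong ℤ.-_ (ℚ.↥-neg p) ⟨
  ℤ.- ℚ.↥ (ℚ.- p)                           ≤⟨ ℤ.neg-mono-≤ (floor*↧≤↥ (ℚ.- p)) ⟩
  ℤ.- (ℚ.floor (ℚ.- p) ℤ.* ℚ.↧ (ℚ.- p))     ≡⟨ ℤ.neg-distribˡ-* (ℚ.floor (ℚ.- p)) _ ⟩
  ceiling p ℤ.* ℚ.↧ (ℚ.- p)                 ≡⟨ cong (ceiling p ℤ.*_) (ℚ.↧-neg p) ⟩
  ceiling p ℤ.* ℚ.↧ p                       ∎
  where open ℤ.≤-Reasoning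

-- `i / d` is stored in lowest terms; multiplying by the gcd restores the original numerator and
-- denominator.
≤ceiling* : ∀ i d .{{_ : ℕ.NonZero d}} → i ℤ.≤ ceiling (i / d) ℤ.* + d
≤ceiling* i d = begin
  i                                ≡⟨ ℚ.↥-/ i d ⟨
  ℚ.↥ p ℤ.* g                      ≤⟨ ℤ.*-monoʳ-≤-nonNeg g (↥≤ceiling*↧ p) ⟩
  ceiling p ℤ.* ℚ.↧ p ℤ.* g        ≡⟨ ℤ.*-assoc (ceiling p) (ℚ.↧ p) g ⟩
  ceiling p ℤ.* (ℚ.↧ p ℤ.* g)      ≡⟨ cong (ceiling p ℤ.*_) (ℚ.↧-/ i d) ⟩
  ceiling p ℤ.* + d                ∎
  where
  open ℤ.≤-Reasoning
  p = i / d
  g = ℤ.gcd i (+ d)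

<⇒≤pred : m ℕ.< n → + m ≤ + n - + 1
<⇒≤pred (ℕ.s≤s m≤n) = ℤ.+≤+ m≤n

-- An arbitrary integer `z` stands for the ceiling, so that its sign can be inspected by matching.
∃double-diameter≤ : ∀ n → 2 ℕ.≤ n → ∀ z → + n ≤ z * + 13 →
                    ∃[ s ] (IsDouble {n} s × + diameter s ≤ + 5 * z - + 1)
∃double-diameter≤ n 2≤n (+ k) n≤z*13 =
  let n≤13k = subst (n ℕ.≤_) (ℕ.*-comm k 13)
                (ℤ.drop‿+≤+ (subst (+ n ≤_) (sym (ℤ.pos-* k 13)) n≤z*13))
      s , dbl , d<5k = ∃double-diameter< {k = k} 2≤n n≤13k
  in s , dbl , subst (λ w → + diameter s ≤ w - + 1) (ℤ.pos-* 5 k) (<⇒≤pred d<5k)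
-- A negative `z` would put `+ n` below a negative number.
∃double-diameter≤ n 2≤n ℤ.-[1+ k ] ()

-- The limit superior.

13δ≤5n+52 : ∀ n → 2 ℕ.≤ n → 13 ℕ.* δ n ℕ.≤ 5 ℕ.* n ℕ.+ 52
-- Adding 13 to both sides turns `δ n` into `suc (δ n)`, to which the strict diameter bound applies.
-- The constant is 52 = 13 * 5 - 13.
13δ≤5n+52 n 2≤n = ℕ.+-cancelʳ-≤ 13 _ _ (begin
  13 ℕ.* δ n ℕ.+ 13                  ≡⟨ lhs (δ n) ⟩
  13 ℕ.* ℕ.suc (δ n)                 ≤⟨ ℕ.*-monoʳ-≤ 13 (ℕ.≤-<-trans (δ-minimal s dbl) d<5k) ⟩
  13 ℕ.* (5 ℕ.* ℕ.suc q)             ≡⟨ rhs q ⟩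
  5 ℕ.* (q ℕ.* 13) ℕ.+ 52 ℕ.+ 13     ≤⟨ ℕ.+-monoˡ-≤ 13 (ℕ.+-monoˡ-≤ 52
                                         (ℕ.*-monoʳ-≤ 5 (ℕ.m/n*n≤m n 13))) ⟩
  5 ℕ.* n ℕ.+ 52 ℕ.+ 13              ∎)
  where
  open ℕ.≤-Reasoning
  q = n ℕ./ 13
  lhs : ∀ d → 13 ℕ.* d ℕ.+ 13 ≡ 13 ℕ.* ℕ.suc d
  lhs = solve-∀
  rhs : ∀ q → 13 ℕ.* (5 ℕ.* ℕ.suc q) ≡ 5 ℕ.* (q ℕ.* 13) ℕ.+ 52 ℕ.+ 13
  rhs = solve-∀
  n≤13k : n ℕ.≤ 13 ℕ.* ℕ.suc q
  n≤13k = begin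
    n                         ≡⟨ ℕ.m≡m%n+[m/n]*n n 13 ⟩
    n ℕ.% 13 ℕ.+ q ℕ.* 13     ≤⟨ ℕ.+-monoˡ-≤ (q ℕ.* 13) (ℕ.<⇒≤ (ℕ.m%n<n n 13)) ⟩
    ℕ.suc q ℕ.* 13            ≡⟨ ℕ.*-comm (ℕ.suc q) 13 ⟩
    13 ℕ.* ℕ.suc q            ∎
  double = ∃double-diameter< {k = ℕ.suc q} 2≤n n≤13k
  s = proj₁ double
  dbl = proj₁ (proj₂ double)
  d<5k = proj₂ (proj₂ double)

limsup-δ/n : limsup δ/n ≤ (+ 5 / 13)
limsup-δ/n (ℚ.mkℚ (+ 0) _ _) (ℚ.*<* (ℤ.+<+ ()))
limsup-δ/n (ℚ.mkℚ ℤ.-[1+ _ ] _ _) (ℚ.*<* ())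
-- Here ε = p/q with p ≥ 1, so the error term 4/n is at most 1/q ≤ ε as soon as n ≥ 4q.
limsup-δ/n ε@(ℚ.mkℚ ℤ.+[1+ p-1 ] q-1 _) _ = 4 ℕ.* q , tail
  where
  p = ℕ.suc p-1
  q = ℕ.suc q-1

  -- This is δ(n)/n ≤ 5/13 + p/q with denominators cleared.
  cross : ∀ n → 4 ℕ.* q ℕ.≤ n → δ n ℕ.* (13 ℕ.* q) ℕ.≤ (5 ℕ.* q ℕ.+ p ℕ.* 13) ℕ.* n
  cross n 4q≤n = begin
    δ n ℕ.* (13 ℕ.* q)                  ≡⟨ lhs (δ n) q ⟩
    13 ℕ.* δ n ℕ.* q                    ≤⟨ ℕ.*-monoˡ-≤ q (13δ≤5n+52 n 2≤n) ⟩
    (5 ℕ.* n ℕ.+ 52) ℕ.* q              ≡⟨ mid n q ⟩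
    5 ℕ.* q ℕ.* n ℕ.+ 13 ℕ.* (4 ℕ.* q)  ≤⟨ ℕ.+-monoʳ-≤ (5 ℕ.* q ℕ.* n)
                                             (ℕ.*-mono-≤ (ℕ.m≤n*m 13 p) 4q≤n) ⟩
    5 ℕ.* q ℕ.* n ℕ.+ p ℕ.* 13 ℕ.* n    ≡⟨ ℕ.*-distribʳ-+ n (5 ℕ.* q) (p ℕ.* 13) ⟨
    (5 ℕ.* q ℕ.+ p ℕ.* 13) ℕ.* n        ∎
    where
    open ℕ.≤-Reasoning
    2≤n : 2 ℕ.≤ n
    2≤n = ℕ.≤-trans (ℕ.≤-trans (ℕ.s≤s (ℕ.s≤s ℕ.z≤n)) (ℕ.m≤m*n 4 q)) 4q≤n
    lhs : ∀ d q → d ℕ.* (13 ℕ.* q) ≡ 13 ℕ.* d ℕ.* q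
    lhs = solve-∀
    mid : ∀ n q → (5 ℕ.* n ℕ.+ 52) ℕ.* q ≡ 5 ℕ.* q ℕ.* n ℕ.+ 13 ℕ.* (4 ℕ.* q)
    mid = solve-∀

  tail : ∀ n → 4 ℕ.* q ℕ.≤ n → δ/n n ℚ.≤ (+ 5 / 13) ℚ.+ ε
  -- Among unnormalised rationals the order is plain cross-multiplication and no gcd intervenes, so
  -- `cross` applies directly.
  tail n@(ℕ.suc n-1) 4q≤n = ℚ.toℚᵘ-cancel-≤ (begin
    ℚ.toℚᵘ (+ δ n / n)                        ≃⟨ ℚ.toℚᵘ-fromℚᵘ (ℚᵘ.mkℚᵘ (+ δ n) n-1) ⟩
    ℚᵘ.mkℚᵘ (+ δ n) n-1                       ≤⟨ ℚᵘ.*≤* (subst₂ _≤_ (ℤ.pos-* (δ n) (13 ℕ.* q))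
                                                    (ℤ.pos-* (5 ℕ.* q ℕ.+ p ℕ.* 13) n)
                                                    (ℤ.+≤+ (cross n 4q≤n))) ⟩
    ℚ.toℚᵘ (+ 5 / 13) ℚᵘ.+ ℚ.toℚᵘ ε           ≃⟨ ℚ.toℚᵘ-homo-+ (+ 5 / 13) ε ⟨
    ℚ.toℚᵘ ((+ 5 / 13) ℚ.+ ε)                 ∎)
    where open ℚᵘ.≤-Reasoning

theorem3p7 : (∀ (n : ℕ) → 2 ℕ.≤ n → ∃[ s ] (IsDouble {n} s × + diameter s ≤ + 5 * ceiling (+ n / 13) - + 1))
    × (∀ (n : ℕ) → 2 ℕ.≤ n → + δ n ≤ + 5 * ceiling (+ n / 13) - + 1)
    × (limsup δ/n ≤ (+ 5 / 13))
theorem3p7 = strings , δ-bound , limsup-δ/n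
  where
  strings : ∀ n → 2 ℕ.≤ n → ∃[ s ] (IsDouble {n} s × + diameter s ≤ + 5 * ceiling (+ n / 13) - + 1)
  strings n 2≤n = ∃double-diameter≤ n 2≤n (ceiling (+ n / 13)) (≤ceiling* (+ n) 13)

  δ-bound : ∀ n → 2 ℕ.≤ n → + δ n ≤ + 5 * ceiling (+ n / 13) - + 1
  δ-bound n 2≤n = let s , dbl , d≤ = strings n 2≤n in ℤ.≤-trans (ℤ.+≤+ (δ-minimal s dbl)) d≤
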